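{- Let $t, k, g$ be integers such that $t, k \geq 2$ and $g \geq \max\{4, k+1\}$, and let $F$ be a connected graph of order $k$ and constant link $L$ and with circumference $c$. Then there is an integer $n$ such that, for any $q \geq 1$, there is a connected graph of constant link $tL$ and order $qn$ without cycles of length $\ell$ for any $c < \ell < g$.
   Context: All graphs are finite and simple; order means number of vertices. A graph $G$ has constant link $L$ if for every vertex $v$ the subgraph induced by the open neighborhood $N(v)$ is isomorphic to $L$; $tL$ is the disjoint union of $t$ copies of $L$. The circumference of a graph is the length of a longest cycle in it. -}

module Defs where

open import Data.Bool using (Bool; true; false; T; _∧_)
open import Data.Fin using (Fin)
open import Data.Fin.Properties using (_≟_)
open import Data.List using (_∷_; _∷ʳ_; length)
open import Data.List.Relation.Unary.Linked using (Linked)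
open import Data.List.Relation.Unary.Unique.Propositional using (Unique)
open import Data.Nat using (ℕ; _≤_)
open import Data.Product using (Σ; ∃; _×_; _,_; proj₁)
open import Data.Sum using (_⊎_)
open import Function using (_∘_; _on_)
open import Function.Bundles using (_↔_; Inverse)
open import Relation.Binary.Construct.Closure.ReflexiveTransitive using (Star)
open import Relation.Binary.PropositionalEquality using (_≡_; refl; sym; cong₂)
open import Relation.Nullary using (yes; no; does; contradiction)

-- Adjacency is Bool-valued so that "u is adjacent to v" is decidable and
-- proof-irrelevant; in particular the vertices of an induced subgraph are
-- counted without multiplicity.
record Graph : Set₁ where
  field
    V      : Set
    adj    : V → V → Bool
    symm   : ∀ u v → adj u v ≡ adj v u
    irrefl : ∀ v → adj v v ≡ false

  _~_ : V → V → Set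
  u ~ v = T (adj u v)

open Graph public using (V; adj)

HasOrder : Graph → ℕ → Set
HasOrder G n = V G ↔ Fin n

Finite : Graph → Set
Finite G = ∃ (HasOrder G)

record _≅_ (G H : Graph) : Set where
  field
    bijection : V G ↔ V H
    preserves : ∀ u v → adj H (Inverse.to bijection u) (Inverse.to bijection v) ≡ adj G u v

induced : (G : Graph) → (V G → Bool) → Graph
induced G P = record
  { V      = Σ (V G) (T ∘ P)
  ; adj    = adj G on proj₁
  ; symm   = λ (u , _) (v , _) → Graph.symm G u v
  ; irrefl = λ (v , _) → Graph.irrefl G v
  }

link : (G : Graph) → V G → Graph
link G v = induced G (adj G v)

ConstantLink : Graph → Graph → Set
ConstantLink G L = ∀ v → link G v ≅ L

copies : ℕ → Graph → Graph
copies t L = record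
  { V      = Fin t × V L
  ; adj    = λ (i , u) (j , v) → does (i ≟ j) ∧ adj L u v
  ; symm   = λ (i , u) (j , v) → cong₂ _∧_ (≟-symm i j) (Graph.symm L u v)
  ; irrefl = λ (i , v) → ∧-false (does (i ≟ i)) (Graph.irrefl L v)
  }
  where
  ≟-symm : (i j : Fin t) → does (i ≟ j) ≡ does (j ≟ i)
  ≟-symm i j with i ≟ j | j ≟ i
  ... | yes _ | yes _ = refl
  ... | no  _ | no  _ = refl
  ... | yes p | no ¬q = contradiction (sym p) ¬q
  ... | no ¬p | yes q = contradiction (sym q) ¬p

  ∧-false : ∀ b {b′} → b′ ≡ false → b ∧ b′ ≡ false
  ∧-false true  p = p
  ∧-false false _ = refl

-- The graph with no vertices is not connected.
Connected : Graph → Set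
Connected G = V G × (∀ u v → Star (Graph._~_ G) u v)

-- The list v ∷ vs enumerates the distinct vertices of the cycle in cyclic
-- order; the closing edge joins the last of them to v.
HasCycle : Graph → ℕ → Set
HasCycle G ℓ = 3 ≤ ℓ × ∃ λ v → ∃ λ vs →
  length (v ∷ vs) ≡ ℓ × Unique (v ∷ vs) × Linked (Graph._~_ G) ((v ∷ vs) ∷ʳ v)

-- An acyclic graph has circumference 0.
HasCircumference : Graph → ℕ → Set
HasCircumference G c =
  (HasCycle G c ⊎ c ≡ 0) × (∀ ℓ → HasCycle G ℓ → ℓ ≤ c)

{-# OPTIONS --safe #-}
module Submission where

-- Take a hypergraph whose hyperedges ("blocks") are copies of V F, each
-- vertex lying in t of them; if its incidence graph has large girth, then
-- replacing every block by a copy of F gives a graph with constant link tL, and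
-- a cycle of length less than g lies in a single block, hence has length at
-- most c.  Start from t coincident blocks.  Passing to the cover with an
-- independent binary voltage on every incidence raises the girth: a shortest
-- closed trail uses its first incidence only once, so it does not close up
-- upstairs.  Take a component of the result, with n points.  It still has an
-- incidence that is not a bridge, and putting a cyclic shift on that incidence
-- gives a connected q-fold cover.

open import Data.Bool using (Bool; true; false; T; not; if_then_else_)
open import Data.Bool.Properties using (T-irrelevant; not-¬; not-involutive)
open import Data.Empty using (⊥-elim)
open import Data.Fin using (Fin; zero; suc; inject₁; fromℕ; combine)
open import Data.Fin.Induction using (<-weakInduction)
open import Data.Fin.Properties
  using (_≟_; any?; 0↔⊥; 1↔⊤; 2↔Bool; +↔⊎; *↔×; combine-injective)
open import Data.Fin.Relation.Unary.Top using (view; ‵fromℕ; ‵inj₁; ‵inject₁; view-fromℕ; view-inject₁)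
open import Data.List using (List; []; _∷_; _∷ʳ_; length; map)
open import Data.List.Properties using (length-map; map-∘; map-++; map-id-local)
open import Data.List.Relation.Unary.All as All using (All; []; _∷_)
open import Data.List.Relation.Unary.All.Properties using () renaming (++⁺ to All-++⁺; ++⁻ˡ to All-++⁻ˡ)
open import Data.List.Relation.Unary.AllPairs as AllPairs using ([]; _∷_)
import Data.List.Relation.Unary.AllPairs.Properties as AllPairs
open import Data.List.Relation.Unary.Linked using (Linked; []; [-]; _∷_)
import Data.List.Relation.Unary.Linked.Properties as Linked
open import Data.List.Relation.Unary.Any using (here; there)
open import Data.List.Membership.Propositional using (_∈_)
open import Data.List.Membership.Propositional.Properties using (∈-++⁺ʳ)
open import Data.List.Relation.Unary.Unique.Propositional using (Unique)
open import Data.Nat using (ℕ; zero; suc; _+_; _*_; _⊔_; _≤_; _<_; _≥_; z≤n; s≤s; s≤s⁻¹)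
open import Data.Nat.Properties
  using (≤-trans; ≤-reflexive; <⇒≱; n≤1+n; m≤n+m; m⊔n≤o⇒m≤o; +-comm; +-suc)
open import Data.Product using (Σ; ∃; _×_; _,_; proj₁; proj₂)
open import Data.Product.Function.NonDependent.Propositional using (_×-↔_)
open import Data.Sum using (_⊎_; inj₁; inj₂)
open import Data.Sum.Function.Propositional using (_⊎-↔_)
open import Data.Unit using (tt)
open import Data.Vec as Vec using (Vec; []; _∷_; lookup; updateAt; replicate)
open import Data.Vec.Properties
  using (lookup∘updateAt; lookup∘updateAt′; updateAt-commutes; updateAt-updateAt-local; updateAt-id)
open import Function using (_∘_; _on_)
open import Function.Bundles using (_↔_; Inverse; mk↔ₛ′)
open import Function.Related.TypeIsomorphisms using (×-comm)
open import Function.Properties.Inverse using (↔-sym; ↔-trans; ↔-refl)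
open import Level using (0ℓ)
open import Relation.Binary using (Decidable; DecidableEquality; Rel)
open import Relation.Binary.Construct.Closure.ReflexiveTransitive
  using (Star; ε; _◅_; _◅◅_; gmap; kleisliStar; reverse; return)
open import Relation.Binary.PropositionalEquality
  using (_≡_; _≢_; refl; sym; trans; cong; cong₂; subst; ≢-sym; module ≡-Reasoning)
open import Relation.Nullary using (¬_; yes; no; contradiction)
open import Relation.Nullary.Decidable using (map′; ⌊_⌋; toWitness; fromWitness; T?; _×-dec_; _⊎-dec_)
open import Defs

-- Finite sets

Enumerable : Set → Set
Enumerable A = ∃ λ n → A ↔ Fin n

enumerable-↔ : ∀ {A B} → A ↔ B → Enumerable B → Enumerable A
enumerable-↔ f (n , g) = n , ↔-trans f g

enumerable-⊎ : ∀ {A B} → Enumerable A → Enumerable B → Enumerable (A ⊎ B)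
enumerable-⊎ (m , f) (n , g) = m + n , ↔-trans (f ⊎-↔ g) (↔-sym +↔⊎)

enumerable-× : ∀ {A B} → Enumerable A → Enumerable B → Enumerable (A × B)
enumerable-× (m , f) (n , g) = m * n , ↔-trans (f ×-↔ g) (↔-sym *↔×)

enumerable-Vec : ∀ {A} → Enumerable A → ∀ n → Enumerable (Vec A n)
enumerable-Vec A zero    = 1 , ↔-trans (mk↔ₛ′ (λ _ → tt) (λ _ → []) (λ _ → refl) (λ { [] → refl })) (↔-sym 1↔⊤)
enumerable-Vec A (suc n) = enumerable-↔
  (mk↔ₛ′ (λ xs → Vec.head xs , Vec.tail xs) (λ (x , xs) → x ∷ xs) (λ _ → refl) (λ { (x ∷ xs) → refl }))
  (enumerable-× A (enumerable-Vec A n))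

enumerable-T : ∀ b → Enumerable (T b)
enumerable-T true  = 1 , ↔-sym 1↔⊤
enumerable-T false = 0 , ↔-sym 0↔⊥

Σ-T-≡ : ∀ {A : Set} (P : A → Bool) {x y : Σ A (T ∘ P)} → proj₁ x ≡ proj₁ y → x ≡ y
Σ-T-≡ P {x , p} {.x , q} refl = cong (x ,_) (T-irrelevant p q)

enumerable-subset-Fin : ∀ {n} (P : Fin n → Bool) → Enumerable (Σ (Fin n) (T ∘ P))
enumerable-subset-Fin {zero}  P = 0 , mk↔ₛ′ proj₁ (λ ()) (λ ()) (λ ())
enumerable-subset-Fin {suc n} P = enumerable-↔
  (mk↔ₛ′ (λ { (zero , p) → inj₁ p ; (suc i , p) → inj₂ (i , p) })
         (λ { (inj₁ p) → zero , p ; (inj₂ (i , p)) → suc i , p })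
         (λ { (inj₁ _) → refl ; (inj₂ _) → refl })
         (λ { (zero , _) → refl ; (suc _ , _) → refl }))
  (enumerable-⊎ (enumerable-T (P zero)) (enumerable-subset-Fin (P ∘ suc)))

enumerable-subset : ∀ {A} → Enumerable A → (P : A → Bool) → Enumerable (Σ A (T ∘ P))
enumerable-subset (n , f) P = enumerable-↔
  (mk↔ₛ′ (λ (x , p) → to x , subst (T ∘ P) (sym (strictlyInverseʳ x)) p)
         (λ (i , p) → from i , p)
         (λ (i , p) → Σ-T-≡ (P ∘ from) (strictlyInverseˡ i))
         (λ (x , p) → Σ-T-≡ P (strictlyInverseʳ x)))
  (enumerable-subset-Fin (P ∘ from))
  where open Inverse f

↔-injective : ∀ {A B : Set} (f : A ↔ B) {x y} → Inverse.to f x ≡ Inverse.to f y → x ≡ y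
↔-injective f {x} {y} eq = trans (sym (strictlyInverseʳ x)) (trans (cong from eq) (strictlyInverseʳ y))
  where open Inverse f

enumerable⇒≟ : ∀ {A} → Enumerable A → DecidableEquality A
enumerable⇒≟ (n , f) x y = map′ (↔-injective f) (cong (Inverse.to f)) (Inverse.to f x ≟ Inverse.to f y)

-- Reachability is decided by eliminating the vertex zero, as in Warshall's algorithm.
star? : ∀ {n} {R : Rel (Fin n) 0ℓ} → Decidable R → Decidable (Star R)
star? {zero} R? ()
star? {suc n} {R} R? = decide
  where
  Bypass : Rel (Fin n) 0ℓ
  Bypass u v = R (suc u) (suc v) ⊎ (R (suc u) zero × R zero (suc v))

  bypass? : Decidable (Star Bypass)
  bypass? = star? λ u v → R? (suc u) (suc v) ⊎-dec (R? (suc u) zero ×-dec R? zero (suc v))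

  expand : ∀ {u v} → Star Bypass u v → Star R (suc u) (suc v)
  expand = kleisliStar suc λ { (inj₁ r) → return r ; (inj₂ (r , s)) → r ◅ s ◅ ε }

  contract  : ∀ {u v} → Star R (suc u) (suc v) → Star Bypass u v
  contract₀ : ∀ {u v} → R (suc u) zero → Star R zero (suc v) → Star Bypass u v
  contract ε                        = ε
  contract (_◅_ {j = zero}  r rs)   = contract₀ r rs
  contract (_◅_ {j = suc _} r rs)   = inj₁ r ◅ contract rs
  contract₀ q (_◅_ {j = zero}  _ rs) = contract₀ q rs
  contract₀ q (_◅_ {j = suc _} r rs) = inj₂ (q , r) ◅ contract rs

  leave : ∀ {v} → Star R zero (suc v) → ∃ λ w → R zero (suc w) × Star Bypass w v
  leave (_◅_ {j = zero}  _ rs) = leave rs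
  leave (_◅_ {j = suc w} r rs) = w , r , contract rs

  arrive : ∀ {u} → Star R (suc u) zero → ∃ λ w → Star Bypass u w × R (suc w) zero
  -- The first arrival at `zero` suffices: what follows starts at `zero` and returns there.
  arrive (_◅_ {j = zero} r _) = _ , ε , r
  arrive (_◅_ {j = suc _} r rs) with arrive rs
  ... | w , ss , q = w , inj₁ r ◅ ss , q

  decide : Decidable (Star R)
  decide zero    zero    = yes ε
  decide (suc u) (suc v) = map′ expand contract (bypass? u v)
  decide zero    (suc v) = map′ (λ (_ , r , rs) → r ◅ expand rs) leave
    (any? λ w → R? zero (suc w) ×-dec bypass? w v)
  decide (suc u) zero    = map′ (λ (_ , rs , r) → expand rs ◅◅ return r) arrive
    (any? λ w → bypass? u w ×-dec R? (suc w) zero)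

enumerable⇒star? : ∀ {A} {R : Rel A 0ℓ} → Enumerable A → Decidable R → Decidable (Star R)
enumerable⇒star? {A} {R} (n , f) R? x y = map′
  (λ rs → subst (Star R x) (strictlyInverseʳ y) (subst (λ z → Star R z _) (strictlyInverseʳ x) (gmap from (λ r → r) rs)))
  (gmap to λ {u} {v} r → subst (R _) (sym (strictlyInverseʳ v)) (subst (λ z → R z v) (sym (strictlyInverseʳ u)) r))
  (star? {R = R on from} (λ i j → R? (from i) (from j)) (to x) (to y))
  where open Inverse f

-- Hypergraphs

-- Each point lies in exactly one block of each direction i : Fin t, and the
-- points of a block are labelled bijectively by K: the point with label b in
-- the i-block of p is move i b p.
record Hypergraph (t : ℕ) (K : Set) : Set₁ where
  field
    Point     : Set
    lab       : Fin t → Point → K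
    move      : Fin t → K → Point → Point
    lab-move  : ∀ i b p → lab i (move i b p) ≡ b
    move-move : ∀ i b c p → move i b (move i c p) ≡ move i b p
    move-lab  : ∀ i p → move i (lab i p) p ≡ p

  -- Membership of two points in a common i-block, expressed without a separate type of blocks.
  Joined : Fin t → Rel Point 0ℓ
  Joined i p q = move i (lab i q) p ≡ q

  Adjacent : Rel Point 0ℓ
  Adjacent p q = ∃ λ i → Joined i p q

  Connected′ : Set
  Connected′ = ∀ p q → Star Adjacent p q

  -- Consecutive steps use different blocks, but the first and the last may agree.
  data Trail : Point → Point → Fin t → ℕ → Set where
    single : ∀ {p q i} → Joined i p q → lab i p ≢ lab i q → Trail p q i 1
    cons   : ∀ {p q r i j n} → Joined i p q → lab i p ≢ lab i q → i ≢ j →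
             Trail q r j n → Trail p r i (suc n)

  -- Equivalently, the incidence graph has girth greater than 2m: a trail of n steps is a
  -- non-backtracking walk of length 2n in it.
  NoShortTrail : ℕ → Set
  NoShortTrail m = ∀ {p i n} → n ≤ m → ¬ Trail p p i n

  -- A step uses two incidences, those of its endpoints with the block, so in direction `i` both
  -- endpoints have to differ from `p`.
  Avoiding : Fin t → Point → Rel Point 0ℓ
  Avoiding i p a b = ∃ λ j → Joined j a b × (j ≡ i → a ≢ p × b ≢ p)

  -- The incidence of p with its i-block is not a bridge of the incidence graph.
  NonBridge : Fin t → Point → Set
  NonBridge i p = ∃ λ q → Joined i p q × q ≢ p × Star (Avoiding i p) p q

  joined-move : ∀ i b p → Joined i p (move i b p)
  joined-move i b p = cong (λ c → move i c p) (lab-move i b p)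

  joined-sym : ∀ {i p q} → Joined i p q → Joined i q p
  joined-sym {i} {p} {q} pq = trans (cong (move i (lab i p)) (sym pq)) (trans (move-move i _ _ p) (move-lab i p))

  joined-trans : ∀ {i p q r} → Joined i p q → Joined i q r → Joined i p r
  joined-trans {i} {p} {q} {r} pq qr = trans (sym (move-move i _ _ p)) (trans (cong (move i (lab i r)) pq) qr)

  joined-lab-injective : ∀ {i p q} → Joined i p q → lab i p ≡ lab i q → p ≡ q
  joined-lab-injective {i} {p} pq eq = trans (sym (move-lab i p)) (trans (cong (λ c → move i c p) eq) pq)

  adjacent-sym : ∀ {p q} → Adjacent p q → Adjacent q p
  adjacent-sym (i , pq) = i , joined-sym pq


-- Covers from voltages on incidences

module Cover {t K} (H : Hypergraph t K) (S : Set) (φ ψ : Fin t → Hypergraph.Point H → S → S)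
  (φ∘ψ : ∀ i p s → φ i p (ψ i p s) ≡ s) (ψ∘φ : ∀ i p s → ψ i p (φ i p s) ≡ s) where
  open Hypergraph H

  -- `φ i p` is the voltage read from the point `p` to its i-block and `ψ i p` is its inverse.
  -- Passing from `p` to `q` inside a block therefore applies `φ i p` and then `ψ i q` to the sheet.
  cover : Hypergraph t K
  cover = record
    { Point     = Point × S
    ; lab       = λ i (p , _) → lab i p
    ; move      = λ i b (p , s) → arrive i p s (move i b p)
    ; lab-move  = λ i b (p , _) → lab-move i b p
    ; move-move = λ i b c (p , s) → trans
        (cong (λ s′ → move i b (move i c p) , ψ i (move i b (move i c p)) s′) (φ∘ψ i (move i c p) _))
        (cong (arrive i p s) (move-move i b c p))
    ; move-lab  = λ i (p , s) → trans (cong (arrive i p s) (move-lab i p)) (cong (p ,_) (ψ∘φ i p s))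
    }
    where
    arrive : Fin t → Point → S → Point → Point × S
    arrive i p s q = q , ψ i q (φ i p s)

  module C = Hypergraph cover

  project : ∀ {i x y} → C.Joined i x y → Joined i (proj₁ x) (proj₁ y)
  project = cong proj₁

  joined⇒≡ : ∀ {i p q s s′} → C.Joined i (p , s) (q , s′) → s′ ≡ ψ i q (φ i p s)
  joined⇒≡ {i} {p} {q} {s} e =
    trans (sym (cong proj₂ e)) (cong (λ r → ψ i r (φ i p s)) (project e))

  lift : ∀ {i p q} s → Joined i p q → C.Joined i (p , s) (q , ψ i q (φ i p s))
  lift {i} {p} s pq = cong (λ r → r , ψ i r (φ i p s)) pq

  project-trail : ∀ {x y i n} → C.Trail x y i n → Trail (proj₁ x) (proj₁ y) i n
  project-trail (C.single e l)     = single (project e) l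
  project-trail (C.cons e l i≢j w) = cons (project e) l i≢j (project-trail w)

  project-noShortTrail : ∀ {m} → NoShortTrail m → C.NoShortTrail m
  project-noShortTrail g n≤m w = g n≤m (project-trail w)

  lift-star : ∀ {p q} → Star Adjacent p q → ∀ s → ∃ λ s′ → Star C.Adjacent (p , s) (q , s′)
  lift-star ε s = s , ε
  lift-star ((i , e) ◅ es) s with lift-star es _
  ... | s′ , es′ = s′ , (i , lift s e) ◅ es′

-- Raising the girth

module DoubleCover {t K} (H : Hypergraph t K) (_≟K_ : DecidableEquality K)
  (points : Enumerable (Hypergraph.Point H)) where
  open Hypergraph H

  _≟P_ : DecidableEquality Point
  _≟P_ = enumerable⇒≟ points

  -- One bit per incidence, so each incidence has its own generator in an elementary abelian
  -- 2-group. Vectors keep the fibre enumerable.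
  Voltage : Set
  Voltage = Vec Bool (t * proj₁ points)

  index : Fin t → Point → Fin (t * proj₁ points)
  index i p = combine i (Inverse.to (proj₂ points) p)

  index-injective : ∀ {i j p q} → index i p ≡ index j q → i ≡ j × p ≡ q
  index-injective {i} {j} eq with combine-injective i _ j _ eq
  ... | i≡j , p≡q = i≡j , ↔-injective (proj₂ points) p≡q

  flip : Fin t → Point → Voltage → Voltage
  flip i p s = updateAt s (index i p) not

  flip-involutive : ∀ i p s → flip i p (flip i p s) ≡ s
  flip-involutive i p s = trans (updateAt-updateAt-local (index i p) s (not-involutive _)) (updateAt-id (index i p) s)

  flip-comm : ∀ i p j q s → flip i p (flip j q s) ≡ flip j q (flip i p s)
  flip-comm i p j q s with index i p ≟ index j q
  ... | yes eq rewrite eq = refl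
  ... | no neq = updateAt-commutes (index i p) (index j q) neq s

  bit : Fin t → Point → Voltage → Bool
  bit i p s = lookup s (index i p)

  bit-flip : ∀ i p s → bit i p (flip i p s) ≡ not (bit i p s)
  bit-flip i p s = lookup∘updateAt (index i p) s

  bit-flip-other : ∀ {i p j q} → (j ≡ i → q ≢ p) → ∀ s → bit i p (flip j q s) ≡ bit i p s
  bit-flip-other {i} {p} {j} {q} other s = lookup∘updateAt′ (index i p) (index j q)
    (λ eq → let i≡j , p≡q = index-injective eq in other (sym i≡j) (sym p≡q)) s

  open Cover H Voltage flip flip flip-involutive flip-involutive public

  -- A step from `a` to `b` in direction `j` flips only the bits of `a` and `b` in that direction.
  bit-unchanged : ∀ {i p j a b s s′} → C.Joined j (a , s) (b , s′) →
    (j ≡ i → a ≢ p) → (j ≡ i → b ≢ p) → bit i p s′ ≡ bit i p s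
  bit-unchanged {i} {p} {j} {a} {s = s} e a≢p b≢p = trans (cong (bit i p) (joined⇒≡ e))
    (trans (bit-flip-other b≢p (flip j a s)) (bit-flip-other a≢p s))

  bit-changed : ∀ {i p q s s′} → C.Joined i (p , s) (q , s′) → q ≢ p → bit i p s′ ≡ not (bit i p s)
  bit-changed {i} {p} {s = s} e q≢p = trans (cong (bit i p) (joined⇒≡ e))
    (trans (bit-flip-other {j = i} (λ _ → q≢p) (flip i p s)) (bit-flip i p s))

  -- A closed trail of length m + 1 starting with the incidence (i , p) cannot
  -- use it again: cutting there would leave a shorter closed trail.  So it
  -- changes the corresponding bit exactly once.  The trail from r to w
  -- is the part already traversed, reversed.
  bit-preserved : ∀ {m i p w} → NoShortTrail m → Joined i w p → ∀ {r s s′ l l′ n n′} →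
    Trail r w l′ n′ → l′ ≢ l → C.Trail (r , s) (p , s′) l n → n′ + n ≤ m → bit i p s′ ≡ bit i p s
  bit-preserved {m} {i} {p} {w} g wp {r} {n = n} {n′} seen l′≢l (C.single e r≢p) n′+n≤m =
    bit-unchanged e (λ _ → r≢p′) last
    where
    r≢p′ : r ≢ p
    r≢p′ refl = r≢p refl

    last : _ ≡ i → p ≢ p
    -- A last step in direction `i` puts `r` and `w` in one i-block: either a step from `w` to `r`
    -- closes `seen`, or `w` is `r` and `seen` is closed already.
    last refl with lab i w ≟K lab i r
    ... | no  w≢r = ⊥-elim (g (≤-trans (≤-reflexive (+-comm 1 n′)) n′+n≤m)
      (cons (joined-trans wp (joined-sym (project e))) w≢r (≢-sym l′≢l) seen))
    ... | yes eq with joined-lab-injective (joined-trans wp (joined-sym (project e))) eq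
    ...   | refl = ⊥-elim (g (≤-trans (≤-trans (n≤1+n n′) (≤-reflexive (+-comm 1 n′))) n′+n≤m) seen)
  bit-preserved {m} {i} {p} {w} g wp {n = suc n} {n′} seen l′≢l rest@(C.cons e r≢r′ l≢l″ rest′) n′+n≤m =
    trans
      (bit-preserved g wp (cons (joined-sym (project e)) (≢-sym r≢r′) (≢-sym l′≢l) seen) l≢l″ rest′
        (≤-trans (≤-reflexive (sym (+-suc n′ n))) n′+n≤m))
      -- An earlier visit to `p` would make `rest` or `rest′` a short closed trail in the base.
      (bit-unchanged e
        (λ { _ refl → g (≤-trans (m≤n+m (suc n) n′) n′+n≤m) (project-trail rest) })
        (λ { _ refl → g (≤-trans (n≤1+n n) (≤-trans (m≤n+m (suc n) n′) n′+n≤m)) (project-trail rest′) }))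

  -- The first step flips the bit of its initial incidence and the remaining steps leave it alone,
  -- so the voltages at the two ends differ.
  noShortTrail-suc : ∀ {m} → NoShortTrail m → C.NoShortTrail (suc m)
  noShortTrail-suc g _ (C.single _ p≢p) = p≢p refl
  noShortTrail-suc {m} g {p , s} {i} n≤m (C.cons {q = q , s₁} e p≢q i≢j rest) =
    not-¬ (sym (after rest (s≤s⁻¹ n≤m) i≢j)) (bit-changed e λ { refl → p≢q refl })
    where
    after : ∀ {j n} → C.Trail (q , s₁) (p , s) j n → n ≤ m → i ≢ j → bit i p s ≡ bit i p s₁
    after (C.single e′ _) _ i≢j = bit-unchanged e′ (λ j≡i _ → i≢j (sym j≡i)) (λ j≡i _ → i≢j (sym j≡i))
    -- The second step has a direction other than `i`; reversed, it is the initial `seen`, with `q`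
    -- as `w`.
    after (C.cons e′ l j≢k rest) n≤m i≢j = trans
      (bit-preserved g (joined-sym (project e)) (single (joined-sym (project e′)) (≢-sym l)) j≢k rest n≤m)
      (bit-unchanged e′ (λ j≡i _ → i≢j (sym j≡i)) (λ j≡i _ → i≢j (sym j≡i)))

  -- The effect on voltages of lifting a path. It is a composite of flips, hence commutes with flips
  -- and is an involution; the lifted path avoids every lift of the incidence at once.
  record Holonomy (i : Fin t) (p a b : Point) : Set where
    field
      act        : Voltage → Voltage
      path       : ∀ s₀ s → Star (C.Avoiding i (p , s₀)) (a , s) (b , act s)
      act-flip   : ∀ j q s → act (flip j q s) ≡ flip j q (act s)
      involutive : ∀ s → act (act s) ≡ s
      bit-act    : ∀ s → bit i p (act s) ≡ bit i p s

  holonomy : ∀ {i p a b} → Star (Avoiding i p) a b → Holonomy i p a b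
  holonomy ε = record
    { act = λ s → s ; path = λ _ _ → ε ; act-flip = λ _ _ _ → refl
    ; involutive = λ _ → refl ; bit-act = λ _ → refl }
  holonomy {i} {p} {a} (_◅_ {j = c} (j , ac , avoid) es) = record
    { act        = λ s → act (step s)
    ; path       = λ s₀ s → (j , lift s ac , λ j≡i →
        (λ eq → proj₁ (avoid j≡i) (cong proj₁ eq)) , (λ eq → proj₂ (avoid j≡i) (cong proj₁ eq)))
        ◅ path s₀ (step s)
    ; act-flip   = λ k q s → trans (cong act (step-flip k q s)) (act-flip k q _)
    ; involutive = λ s → trans (cong act (sym (act-step (step s))))
        (trans (involutive _) (step-involutive s))
    ; bit-act    = λ s → trans (bit-act (step s))
        (trans (bit-flip-other (λ j≡i → proj₂ (avoid j≡i)) (flip j a s))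
               (bit-flip-other (λ j≡i → proj₁ (avoid j≡i)) s))
    }
    where
    open Holonomy (holonomy es)

    step : Voltage → Voltage
    step s = flip j c (flip j a s)

    step-flip : ∀ k q s → step (flip k q s) ≡ flip k q (step s)
    step-flip k q s = trans (cong (flip j c) (flip-comm j a k q s)) (flip-comm j c k q _)

    step-involutive : ∀ s → step (step s) ≡ s
    step-involutive s = trans (cong (flip j c) (trans (cong (flip j a) (flip-comm j c j a s)) (flip-involutive j a _)))
      (flip-involutive j c s)

    act-step : ∀ s → act (step s) ≡ step (act s)
    act-step s = trans (act-flip j c _) (cong (flip j c) (act-flip j a s))

  -- Traverse the loop through the incidence (i , p) twice: after the first
  -- round the bit of that incidence has changed, so the second round uses a
  -- different lift of it.
  nonBridge-lift : ∀ {i p} → NonBridge i p → ∀ s → C.NonBridge i (p , s)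
  nonBridge-lift {i} {p} (q , pq , q≢p , es) s =
    (q , flip i q (flip i p s)) , lift s pq , q≢p ∘ cong proj₁ ,
    subst (λ s′ → Star (C.Avoiding i (p , s)) (p , s) (q , s′)) round
      (path s s ◅◅ (i , back , λ _ → q≢p ∘ cong proj₁ , λ eq → not-¬ (cong (bit i p ∘ proj₂) eq) bit-eq) ◅ path s s₂)
    where
    open Holonomy (holonomy es)

    s₂ : Voltage
    s₂ = flip i p (flip i q (act s))

    back : C.Joined i (q , act s) (p , s₂)
    back = lift (act s) (joined-sym pq)

    bit-eq : bit i p s₂ ≡ not (bit i p s)
    bit-eq = trans (bit-flip i p (flip i q (act s)))
      (cong not (trans (bit-flip-other {j = i} (λ _ → q≢p) (act s)) (bit-act s)))

    -- The two traversals of the path cancel, and the flips that remain are those of the step from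
    -- `p` to `q`.
    round : act s₂ ≡ flip i q (flip i p s)
    round = begin
      act s₂                            ≡⟨ act-flip i p _ ⟩
      flip i p (act (flip i q (act s))) ≡⟨ cong (flip i p) (act-flip i q _) ⟩
      flip i p (flip i q (act (act s))) ≡⟨ cong (flip i p ∘ flip i q) (involutive s) ⟩
      flip i p (flip i q s)             ≡⟨ flip-comm i p i q s ⟩
      flip i q (flip i p s)             ∎
      where open ≡-Reasoning

coincidentBlocks : ∀ t K → Hypergraph t K
coincidentBlocks t K = record
  { Point     = K
  ; lab       = λ _ p → p
  ; move      = λ _ b _ → b
  ; lab-move  = λ _ _ _ → refl
  ; move-move = λ _ _ _ _ → refl
  ; move-lab  = λ _ _ → refl
  }

-- A non-bridge incidence is carried through the induction because the final cyclic cover puts its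
-- shift there.
record HighGirth (t : ℕ) (K : Set) (m : ℕ) : Set₁ where
  field
    hypergraph : Hypergraph t K
  open Hypergraph hypergraph public
  field
    points      : Enumerable Point
    girth       : NoShortTrail m
    direction   : Fin t
    point       : Point
    nonBridge   : NonBridge direction point

highGirth : ∀ {t K} → Enumerable K → {i j : Fin t} → i ≢ j → {a b : K} → a ≢ b → ∀ m → HighGirth t K m
highGirth {t} {K} labels {i} {j} i≢j {a} {b} a≢b zero = record
  { hypergraph = coincidentBlocks t K
  ; points     = labels
  ; girth      = λ { z≤n () }
  ; direction  = i
  ; point      = a
  -- The i-block and the j-block both contain `a` and `b`, so the step in direction `j` bypasses the
  -- incidence in direction `i`.
  ; nonBridge  = b , refl , ≢-sym a≢b , (j , refl , λ j≡i → contradiction (sym j≡i) i≢j) ◅ ε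
  }
highGirth labels i≢j a≢b (suc m) = record
  { hypergraph = D.cover
  ; points     = enumerable-× points (enumerable-Vec (2 , ↔-sym 2↔Bool) _)
  ; girth      = D.noShortTrail-suc girth
  ; direction  = direction
  ; point      = point , replicate _ false
  ; nonBridge  = D.nonBridge-lift nonBridge _
  }
  where
  open HighGirth (highGirth labels i≢j a≢b m)
  module D = DoubleCover hypergraph (enumerable⇒≟ labels) points

-- Connected components

module Component {t K} (H : Hypergraph t K) (points : Enumerable (Hypergraph.Point H))
  (p₀ : Hypergraph.Point H) where
  open Hypergraph H

  adjacent? : Decidable Adjacent
  adjacent? p q = any? λ i → enumerable⇒≟ points (move i (lab i q) p) q

  -- Deciding reachability makes membership proof-irrelevant, so that the component can be counted.
  reachable : Point → Bool
  reachable p = ⌊ enumerable⇒star? points adjacent? p₀ p ⌋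

  witness : ∀ {p} → T (reachable p) → Star Adjacent p₀ p
  witness = toWitness

  component : Hypergraph t K
  component = record
    { Point     = Σ Point (T ∘ reachable)
    ; lab       = λ i (p , _) → lab i p
    ; move      = λ i b (p , r) → move i b p , fromWitness (witness r ◅◅ return (i , joined-move i b p))
    ; lab-move  = λ i b (p , _) → lab-move i b p
    ; move-move = λ i b c (p , _) → Σ-T-≡ reachable (move-move i b c p)
    ; move-lab  = λ i (p , _) → Σ-T-≡ reachable (move-lab i p)
    }

  module C = Hypergraph component

  lift : ∀ {i x y} → Joined i (proj₁ x) (proj₁ y) → C.Joined i x y
  lift = Σ-T-≡ reachable

  -- Stated for any `R` within adjacency: it serves both connectedness and the avoiding path of a
  -- non-bridge.
  lift-star : ∀ {R : Rel Point 0ℓ} → (∀ {p q} → R p q → Adjacent p q) →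
    ∀ {p q} r r′ → Star R p q → Star (R on proj₁) (p , r) (q , r′)
  lift-star R⇒Adj r r′ ε = subst (Star _ _) (Σ-T-≡ reachable refl) ε
  lift-star R⇒Adj r r′ (x ◅ xs) =
    x ◅ lift-star R⇒Adj (fromWitness (witness r ◅◅ return (R⇒Adj x))) r′ xs

  connected : C.Connected′
  connected (p , r) (q , r′) = gmap (λ x → x) (λ (i , e) → i , lift e)
    (lift-star (λ e → e) r r′ (reverse adjacent-sym (witness r) ◅◅ witness r′))

  noShortTrail : ∀ {m} → NoShortTrail m → C.NoShortTrail m
  noShortTrail g n≤m w = g n≤m (project w)
    where
    project : ∀ {x y i n} → C.Trail x y i n → Trail (proj₁ x) (proj₁ y) i n
    project (C.single e l)     = single (cong proj₁ e) l
    project (C.cons e l i≢j w) = cons (cong proj₁ e) l i≢j (project w)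

  nonBridge-lift : ∀ {i p} → NonBridge i p → ∀ r → C.NonBridge i (p , r)
  nonBridge-lift {i} {p} (q , pq , q≢p , es) r =
    (q , r′) , lift pq , q≢p ∘ cong proj₁ ,
    gmap (λ x → x)
      (λ (j , e , avoid) → j , lift e , λ j≡i → let a≢p , b≢p = avoid j≡i in a≢p ∘ cong proj₁ , b≢p ∘ cong proj₁)
      (lift-star (λ (j , e , _) → j , e) r r′ es)
    where
    r′ : T (reachable q)
    r′ = fromWitness (witness r ◅◅ return (i , pq))

-- Cyclic covers

-- Subtraction of 1 modulo `suc n`, so that repeated rotation descends to `zero`.
rotate : ∀ {n} → Fin (suc n) → Fin (suc n)
rotate zero    = fromℕ _
rotate (suc i) = inject₁ i

unrotate : ∀ {n} → Fin (suc n) → Fin (suc n)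
unrotate i with view i
... | ‵fromℕ     = zero
... | ‵inject₁ j = suc j

rotate-unrotate : ∀ {n} (i : Fin (suc n)) → rotate (unrotate i) ≡ i
rotate-unrotate i with view i
... | ‵fromℕ  = refl
... | ‵inj₁ _ = refl

unrotate-rotate : ∀ {n} (i : Fin (suc n)) → unrotate (rotate i) ≡ i
unrotate-rotate {n} zero rewrite view-fromℕ n = refl
unrotate-rotate (suc i) rewrite view-inject₁ i = refl

module CyclicCover {t K} (H : Hypergraph t K) (points : Enumerable (Hypergraph.Point H)) (n : ℕ)
  (i₀ : Fin t) (p₀ : Hypergraph.Point H) where
  open Hypergraph H

  _≟I_ : DecidableEquality (Fin t × Point)
  _≟I_ = enumerable⇒≟ (enumerable-× (t , ↔-refl) points)

  atIncidence : (Fin (suc n) → Fin (suc n)) → Fin t → Point → Fin (suc n) → Fin (suc n)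
  atIncidence σ i p s = if ⌊ (i , p) ≟I (i₀ , p₀) ⌋ then σ s else s

  atIncidence-inverse : ∀ σ τ → (∀ s → σ (τ s) ≡ s) → ∀ i p s → atIncidence σ i p (atIncidence τ i p s) ≡ s
  atIncidence-inverse σ τ inv i p s with ⌊ (i , p) ≟I (i₀ , p₀) ⌋
  ... | true  = inv s
  ... | false = refl

  atIncidence-other : ∀ σ {i p} → (i ≡ i₀ → p ≢ p₀) → ∀ s → atIncidence σ i p s ≡ s
  atIncidence-other σ {i} {p} other s with (i , p) ≟I (i₀ , p₀)
  ... | yes refl = contradiction refl (other refl)
  ... | no  _    = refl

  atIncidence-same : ∀ σ s → atIncidence σ i₀ p₀ s ≡ σ s
  atIncidence-same σ s with (i₀ , p₀) ≟I (i₀ , p₀)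
  ... | yes _ = refl
  ... | no ≢  = contradiction refl ≢

  -- With `rotate` as the voltage towards the point, entering `p₀` through its `i₀`-block from
  -- another point lowers the sheet by one.
  open Cover H (Fin (suc n)) (atIncidence unrotate) (atIncidence rotate)
    (atIncidence-inverse unrotate rotate unrotate-rotate) (atIncidence-inverse rotate unrotate rotate-unrotate) public

  -- The path avoids the only incidence with a nontrivial voltage.
  stay : ∀ {p q} → Star (Avoiding i₀ p₀) p q → ∀ s → Star C.Adjacent (p , s) (q , s)
  stay ε s = ε
  stay (_◅_ {i = a} {j = b} (j , ab , avoid) es) s =
    (j , trans (lift s ab) (cong (b ,_) (trans (atIncidence-other rotate (λ j≡i → proj₂ (avoid j≡i)) _)
                                               (atIncidence-other unrotate (λ j≡i → proj₁ (avoid j≡i)) s))))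
    ◅ stay es s

  -- One round of the loop through the non-bridge incidence shifts the sheet by one, which connects
  -- the fibre over `p₀`; lifted paths lead every point into that fibre.
  connected : Connected′ → NonBridge i₀ p₀ → C.Connected′
  connected conn (q , p₀q , q≢p₀ , es) x y =
    toBase x ◅◅ reverse C.adjacent-sym (toBase y)
    where
    turn : ∀ s → Star C.Adjacent (p₀ , s) (p₀ , rotate s)
    turn s = stay es s ◅◅ return (i₀ , trans (lift s (joined-sym p₀q)) (cong (p₀ ,_)
      (trans (cong (atIncidence rotate i₀ p₀) (atIncidence-other unrotate (λ _ → q≢p₀) s)) (atIncidence-same rotate s))))

    toZero : ∀ s → Star C.Adjacent (p₀ , s) (p₀ , zero)
    toZero = <-weakInduction _ ε λ i es → turn (suc i) ◅◅ es

    toBase : ∀ x → Star C.Adjacent x (p₀ , zero)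
    toBase (p , s) with lift-star (conn p p₀) s
    ... | s′ , es = es ◅◅ toZero s′

-- Graphs realized by hypergraphs

T-ext : ∀ {a b} → (T a → T b) → (T b → T a) → a ≡ b
T-ext {true}  {true}  _ _ = refl
T-ext {false} {false} _ _ = refl
T-ext {true}  {false} f _ = ⊥-elim (f tt)
T-ext {false} {true}  _ g = ⊥-elim (g tt)

~-≢ : ∀ (G : Graph) {u v} → T (adj G u v) → u ≢ v
~-≢ G {u} e refl = subst T (Graph.irrefl G u) e

~-sym : ∀ (G : Graph) {u v} → T (adj G u v) → T (adj G v u)
~-sym G {u} {v} = subst T (Graph.symm G u v)

-- Place a copy of F on every block, along its labelling.
module Realization {t} (F : Graph) (H : Hypergraph t (V F)) (points : Enumerable (Hypergraph.Point H)) where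
  open Hypergraph H

  _≟P_ : DecidableEquality Point
  _≟P_ = enumerable⇒≟ points

  Edge : Rel Point 0ℓ
  Edge p q = ∃ λ i → Joined i p q × T (adj F (lab i p) (lab i q))

  edge? : Decidable Edge
  edge? p q = any? λ i → (move i (lab i q) p ≟P q) ×-dec T? (adj F (lab i p) (lab i q))

  edge-sym : ∀ {p q} → Edge p q → Edge q p
  edge-sym (i , pq , a) = i , joined-sym pq , ~-sym F a

  edge-≢ : ∀ {p q} → Edge p q → p ≢ q
  edge-≢ (i , _ , a) p≡q = ~-≢ F a (cong (lab i) p≡q)

  edge : ∀ {p q} → T ⌊ edge? p q ⌋ → Edge p q
  edge = toWitness

  unedge : ∀ {p q} → Edge p q → T ⌊ edge? p q ⌋
  unedge = fromWitness

  graph : Graph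
  graph = record
    { V      = Point
    ; adj    = λ p q → ⌊ edge? p q ⌋
    ; symm   = λ p q → T-ext (unedge ∘ edge-sym ∘ edge) (unedge ∘ edge-sym ∘ edge)
    ; irrefl = λ p → T-ext (λ e → edge-≢ (edge e) refl) λ ()
    }

  -- Points of one block are linked through the connected copy of `F` on it.
  connected : Connected F → Point → Connected′ → Connected graph
  connected (_ , conn) p₀ conn′ = p₀ , λ p q → kleisliStar (λ r → r) along (conn′ p q)
    where
    within : ∀ i p {a b} → Star (Graph._~_ F) a b → Star (Graph._~_ graph) (move i a p) (move i b p)
    within i p = gmap (λ b → move i b p) λ {b} {c} a → unedge
      ( i
      , joined-trans (joined-sym (joined-move i b p)) (joined-move i c p)
      , subst T (sym (cong₂ (adj F) (lab-move i b p) (lab-move i c p))) a)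

    along : ∀ {p q} → Adjacent p q → Star (Graph._~_ graph) p q
    along {p} {q} (i , pq) = subst (λ r → Star _ r q) (move-lab i p)
      (subst (Star _ _) pq (within i p (conn (lab i p) (lab i q))))

  joined-lab-≢ : ∀ {i p q} → Joined i p q → p ≢ q → lab i p ≢ lab i q
  joined-lab-≢ pq p≢q eq = p≢q (joined-lab-injective pq eq)

  -- Links and short cycles under a girth bound

  module _ {m} (girth : NoShortTrail m) (3≤m : 3 ≤ m) where

    2≤m : 2 ≤ m
    2≤m = ≤-trans (n≤1+n 2) 3≤m

    -- Two blocks with two common points would give a closed trail of two steps.
    joined-unique : ∀ {i j p q} → Joined i p q → Joined j p q → p ≢ q → i ≡ j
    joined-unique {i} {j} pq pq′ p≢q with i ≟ j
    ... | yes i≡j = i≡j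
    ... | no  i≢j = ⊥-elim (girth 2≤m (cons pq (joined-lab-≢ pq p≢q) i≢j
      (single (joined-sym pq′) (joined-lab-≢ (joined-sym pq′) (≢-sym p≢q)))))

    edge-joined : ∀ {i p q} → Joined i p q → Edge p q → T (adj F (lab i p) (lab i q))
    edge-joined pq e@(j , pq′ , a) with joined-unique pq pq′ (edge-≢ e)
    ... | refl = a

    adj-joined : ∀ {i p q} → Joined i p q → adj graph p q ≡ adj F (lab i p) (lab i q)
    adj-joined {i} pq = T-ext (edge-joined pq ∘ edge) (λ a → unedge (i , pq , a))

    -- An edge in a third direction closes a trail of three steps; one in direction `i` or `j` makes
    -- two blocks share two points.
    triangle : ∀ {i j p q r} → Joined i p q → p ≢ q → Joined j p r → p ≢ r → i ≢ j → ¬ Edge q r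
    triangle {i} {j} pq p≢q pr p≢r i≢j e@(l , qr , _) with i ≟ l | l ≟ j
    ... | yes refl | _        = i≢j (joined-unique (joined-trans pq qr) pr p≢r)
    ... | _        | yes refl = i≢j (joined-unique pq (joined-trans pr (joined-sym qr)) p≢q)
    ... | no i≢l   | no l≢j   = girth 3≤m (cons pq (joined-lab-≢ pq p≢q) i≢l
      (cons qr (joined-lab-≢ qr (edge-≢ e)) l≢j (single (joined-sym pr) (joined-lab-≢ (joined-sym pr) (≢-sym p≢r)))))

    -- Each neighbour of `p` lies in a unique block with it, the neighbours in one block form the
    -- link of the label of `p` in `F`, and `triangle` excludes edges between blocks.
    constantLink : ∀ {L} → ConstantLink F L → ConstantLink graph (copies t L)
    constantLink {L} iso p = record
      { bijection = mk↔ₛ′ (λ (_ , e) → image (edge e)) preimage image-preimage preimage-image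
      ; preserves = λ (_ , e) (_ , e′) → preserves (edge e) (edge e′)
      }
      where
      module Iso a = _≅_ (iso a)
      module Bij a = Inverse (Iso.bijection a)

      image : ∀ {q} → Edge p q → Fin t × V L
      image {q} (i , _ , a) = i , Bij.to (lab i p) (lab i q , a)

      -- The decision procedure may return any direction; by `joined-unique` it is the prescribed
      -- one.
      image-≡ : ∀ {i q} → Joined i p q → ∀ {x : V (link F (lab i p))} → lab i q ≡ proj₁ x →
        (e : Edge p q) → image e ≡ (i , Bij.to (lab i p) x)
      image-≡ {i} pq eq e@(j , pq′ , a) with joined-unique pq pq′ (edge-≢ e)
      ... | refl = cong (λ x → i , Bij.to (lab i p) x) (Σ-T-≡ (adj F (lab i p)) eq)

      preimage : Fin t × V L → V (link graph p)
      preimage (i , u) with Bij.from (lab i p) u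
      ... | b , a = move i b p , unedge (i , joined-move i b p , subst (T ∘ adj F (lab i p)) (sym (lab-move i b p)) a)

      image-preimage : ∀ x → image (edge (proj₂ (preimage x))) ≡ x
      image-preimage (i , u) = trans
        (image-≡ (joined-move i _ p) (lab-move i _ p) (edge (proj₂ (preimage (i , u)))))
        (cong (i ,_) (Bij.strictlyInverseˡ (lab i p) u))

      preimage-image : ∀ x → preimage (image (edge (proj₂ x))) ≡ x
      preimage-image (q , e) with edge e
      ... | i , pq , a = Σ-T-≡ (adj graph p)
        (trans (cong (λ x → move i (proj₁ x) p) (Bij.strictlyInverseʳ (lab i p) (lab i q , a))) pq)

      preserves : ∀ {q r} (e : Edge p q) (e′ : Edge p r) → adj (copies t L) (image e) (image e′) ≡ adj graph q r
      preserves e@(i , pq , a) e′@(j , pr , a′) with i ≟ j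
      ... | yes refl = trans (Iso.preserves (lab i p) _ _) (sym (adj-joined (joined-trans (joined-sym pq) pr)))
      ... | no i≢j   = T-ext (λ ()) (λ qr → triangle pq (edge-≢ e) pr (edge-≢ e′) i≢j (edge qr))

    -- A path starting in an i-block either stays there or leaves it at some
    -- point w, and what follows w shortens to a trail.
    PathIn : Fin t → Point → List Point → Point → Set
    PathIn i u ys z = All (Joined i u) (ys ∷ʳ z) ⊎
      (∃ λ w → w ∈ ys ∷ʳ z × Joined i u w × ∃ λ j → i ≢ j × ∃ λ n → n ≤ length ys × Trail w z j n)

    -- Consecutive edges in one block merge into a single step, so the trail is no longer than the
    -- path; distinctness of the vertices keeps merged steps from being constant.
    path : ∀ u ys z → Linked (Graph._~_ graph) (u ∷ ys ∷ʳ z) → Unique (u ∷ ys ∷ʳ z) → ∃ λ i → PathIn i u ys z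
    path u [] z (e ∷ [-]) _ = let i , uz , _ = edge e in i , inj₁ (uz ∷ [])
    path u (y ∷ ys) z (e ∷ es) (_ ∷ un@(y≢ ∷ _)) with edge e | path y ys z es un
    ... | i , uy , _ | j , rest with i ≟ j | rest
    ... | yes refl | inj₁ all = i , inj₁ (uy ∷ All.map (joined-trans uy) all)
    ... | yes refl | inj₂ (w , w∈ , yw , l , i≢l , n , n≤ , tr) =
      i , inj₂ (w , there w∈ , joined-trans uy yw , l , i≢l , n , ≤-trans n≤ (n≤1+n _) , tr)
    ... | no i≢j | inj₁ all = i , inj₂ (y , here refl , uy , j , i≢j , 1 , s≤s z≤n ,
      single yz (joined-lab-≢ yz (All.lookup y≢ z∈)))
      where
      z∈ : z ∈ ys ∷ʳ z
      z∈ = ∈-++⁺ʳ ys (here refl)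
      yz : Joined j y z
      yz = All.lookup all z∈
    ... | no i≢j | inj₂ (w , w∈ , yw , l , j≢l , n , n≤ , tr) =
      i , inj₂ (y , here refl , uy , j , i≢j , suc n , s≤s n≤ ,
        cons yw (joined-lab-≢ yw (All.lookup y≢ w∈)) j≢l tr)

    -- Labels carry the cycle into `F`, and stay distinct because `move i b v` recovers a vertex
    -- from its label `b`.
    block-cycle : ∀ {i v vs ℓ} → 3 ≤ ℓ → length (v ∷ vs) ≡ ℓ → Unique (v ∷ vs) →
      Linked (Graph._~_ graph) (v ∷ vs ∷ʳ v) → All (Joined i v) (vs ∷ʳ v) → HasCycle F ℓ
    block-cycle {i} {v} {vs} 3≤ℓ len un es joined =
      3≤ℓ , lab i v , map (lab i) vs , trans (length-map (lab i) (v ∷ vs)) len ,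
      AllPairs.map (λ ≢ eq → ≢ (cong (λ b → move i b v) eq)) (AllPairs.map⁻ (subst Unique (sym relabel) un)) ,
      subst (Linked (Graph._~_ F)) (map-++ (lab i) (v ∷ vs) (v ∷ []))
        (Linked.map⁺ (labelled es (move-lab i v ∷ joined)))
      where
      relabel : map (λ b → move i b v) (map (lab i) (v ∷ vs)) ≡ v ∷ vs
      relabel = trans (sym (map-∘ (v ∷ vs))) (map-id-local (move-lab i v ∷ All-++⁻ˡ vs joined))

      labelled : ∀ {xs} → Linked (Graph._~_ graph) xs → All (Joined i v) xs → Linked (Graph._~_ F on lab i) xs
      labelled []       _               = []
      labelled [-]      _               = [-]
      labelled (e ∷ es) (vx ∷ vy ∷ vxs) =
        edge-joined (joined-trans (joined-sym vx) vy) (edge e) ∷ labelled es (vy ∷ vxs)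

    -- The cycle is its first edge followed by a path from `y` back to `v`. Unless everything lies
    -- in one block, the two combine to a closed trail of at most `m` steps.
    short-cycle : ∀ {ℓ} → ℓ ≤ m → HasCycle graph ℓ → HasCycle F ℓ
    short-cycle ℓ≤m (s≤s () , v , [] , refl , _)
    short-cycle ℓ≤m (3≤ℓ , v , y ∷ ys , refl , un@(v≢@(v≢y ∷ _) ∷ un′) , e ∷ es)
      with edge e | path y ys v es (AllPairs.++⁺ un′ ([] ∷ []) (All.map (λ v≢x → ≢-sym v≢x ∷ []) v≢))
    ... | i , vy , _ | j , rest with i ≟ j | rest
    ... | yes refl | inj₁ all = block-cycle 3≤ℓ refl un (e ∷ es) (vy ∷ All.map (joined-trans vy) all)
    ... | no i≢j   | inj₁ all = ⊥-elim (girth 2≤m (cons vy (joined-lab-≢ vy v≢y) i≢j (single yv (joined-lab-≢ yv (≢-sym v≢y)))))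
      where
      yv : Joined j y v
      yv = All.lookup all (∈-++⁺ʳ ys (here refl))
    ... | yes refl | inj₂ (w , w∈ , yw , l , i≢l , n , n≤ , tr) with v ≟P w
    -- `w` may be the endpoint `v` of the path; then `tr` is already closed.
    ...   | yes refl = ⊥-elim (girth (≤-trans n≤ (≤-trans (≤-trans (n≤1+n _) (n≤1+n _)) ℓ≤m)) tr)
    ...   | no  v≢w  = ⊥-elim (girth (≤-trans (s≤s n≤) (≤-trans (n≤1+n _) ℓ≤m))
      (cons vw (joined-lab-≢ vw v≢w) i≢l tr))
      where
      vw : Joined i v w
      vw = joined-trans vy yw
    -- The tight case: the closed trail has n + 2 steps, and `n ≤ length ys` bounds this by the
    -- length of the cycle.
    short-cycle ℓ≤m (3≤ℓ , v , y ∷ ys , refl , un@(v≢@(v≢y ∷ _) ∷ un′@(y≢ ∷ _)) , e ∷ es)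
      | i , vy , _ | j , rest | no i≢j | inj₂ (w , w∈ , yw , l , j≢l , n , n≤ , tr) =
      ⊥-elim (girth (≤-trans (s≤s (s≤s n≤)) ℓ≤m) (cons vy (joined-lab-≢ vy v≢y) i≢j
        (cons yw (joined-lab-≢ yw (All.lookup (All-++⁺ y≢ (≢-sym v≢y ∷ [])) w∈)) j≢l tr)))

theorem21 : (t k g : ℕ) → t ≥ 2 → k ≥ 2 → g ≥ 4 ⊔ suc k →
    (F L : Graph) (c : ℕ) → Finite L →
    Connected F → HasOrder F k → ConstantLink F L → HasCircumference F c →
    ∃ λ (n : ℕ) → (q : ℕ) → q ≥ 1 →
    ∃ λ (G : Graph) → Connected G × ConstantLink G (copies t L) × HasOrder G (q * n) ×
    (∀ ℓ → c < ℓ → ℓ < g → ¬ HasCycle G ℓ)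
theorem21 t@(suc (suc _)) k@(suc (suc _)) g (s≤s (s≤s _)) (s≤s (s≤s _)) g≥ F L c _ connF order linkF (_ , ≤c)
  with m⊔n≤o⇒m≤o 4 (suc k) g≥
-- Here `g` is `suc m`, so cycles shorter than `g` have length at most `m`. The order `n` is the
-- number of points of the component, chosen before `q`.
... | s≤s {n = m} 3≤m = proj₁ points′ , realize
  where
  -- Two directions exist since t is at least 2, and two labels since k is at least 2.
  open HighGirth (highGirth {t} (k , order) {zero} {suc zero} (λ ())
    {Inverse.from order zero} {Inverse.from order (suc zero)}
    (λ eq → contradiction (↔-injective (↔-sym order) eq) λ ()) m)

  open Component hypergraph points point

  points′ : Enumerable (Hypergraph.Point component)
  points′ = enumerable-subset points reachable

  base : Hypergraph.Point component
  base = point , fromWitness ε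

  realize : (q : ℕ) → q ≥ 1 →
    ∃ λ (G : Graph) → Connected G × ConstantLink G (copies t L) × HasOrder G (q * proj₁ points′) ×
    (∀ ℓ → c < ℓ → ℓ < suc m → ¬ HasCycle G ℓ)
  realize q@(suc n) _ =
    R.graph ,
    R.connected connF (base , zero) (Cyclic.connected connected (nonBridge-lift nonBridge _)) ,
    R.constantLink girth′ 3≤m linkF ,
    ↔-trans (×-comm _ _) (proj₂ (enumerable-× (q , ↔-refl) points′)) ,
    -- A cycle shorter than `g` yields one of the same length in `F`, which is at most `c`.
    λ { ℓ c<ℓ (s≤s ℓ≤m) cycle → <⇒≱ c<ℓ (≤c ℓ (R.short-cycle girth′ 3≤m ℓ≤m cycle)) }
    where
    module Cyclic = CyclicCover component points′ n direction base
    module R = Realization F Cyclic.cover (enumerable-× points′ (q , ↔-refl))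

    girth′ : Hypergraph.NoShortTrail Cyclic.cover m
    girth′ = Cyclic.project-noShortTrail (noShortTrail girth)
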